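{- Let $A$ be a commutative ring, $k\ge1$, and $\vec s=(n_1,\dots,n_k)$ a tuple of positive integers. For every $p\ge-1$ and every $\sigma\in\operatorname{Stab}(\vec s)$, the shift-and-truncate homotopy $H_p:X_p\to X_{p+1}$ on the diagonal simplicial tensor module $X_\bullet=X_\bullet(\vec s;A)$ is equivariant: $$H_p(\sigma\cdot T)=\sigma\cdot H_p(T)\qquad\text{for all }T\in X_p.$$
   Context: Notation: $[p]=\{0,\dots,p\}$. For a shape $\vec s=(n_1,\dots,n_k)$ put $n=\min(n_1,\dots,n_k)-1$, $M_a(p)=n_a-1-n+p$ (so $M_a(p)\ge p$), $I_p=\prod_{a=1}^k[M_a(p)]$ for $p\ge 0$, and $X_p=X_p(\vec s;A)=A^{I_p}$ (all functions $T:I_p\to A$); $X_p=0$ for $p<0$. $\operatorname{Stab}(\vec s)=\{\sigma\in S_k: n_{\sigma(a)}=n_a\text{ for all }a\}$ acts on $I_p$ by $\sigma\cdot(m_1,\dots,m_k)=(m_{\sigma^{ -1}(1)},\dots,m_{\sigma^{ -1}(k)})$ and on $X_p$ by $(\sigma\cdot T)(m)=T(\sigma^{ -1}\cdot m)$. The shift-and-truncate homotopy $H_p:X_p\to X_{p+1}$ is defined by $H_{ -1}=0$ and, for $p\ge0$, $T\in X_p$, $m\in I_{p+1}$: $H_p(T)(m)=0$ if some $m_a=0$, and $H_p(T)(m)=T(m-\vec 1)$ if $m_a>0$ for all $a$, where $\vec1=(1,\dots,1)$. -}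

module Defs where

open import Algebra.Bundles using (CommutativeRing)
open import Algebra.Module.Bundles using (Module)
open import Algebra.Module.Structures using (IsModule)
open import Algebra.Module.Structures.Biased using (module IsModuleFromLeft)
import Algebra.Module.Construct.Zero as Zero
open import Data.Fin.Base using (Fin; toℕ; cast; reduce≥)
open import Data.Fin.Permutation using (Permutation′; _⟨$⟩ʳ_; _⟨$⟩ˡ_; flip; inverseʳ)
open import Data.Fin.Properties using (all?)
open import Data.Integer.Base as ℤ using (ℤ; +_; -[1+_])
open import Data.List.Extrema.Nat using (min)
open import Data.Nat.Base using (ℕ; suc; _+_; _∸_; _≤_)
open import Data.Nat.Properties using (_≤?_)
open import Data.Product.Base using (_,_)
open import Data.Vec.Functional using (Vector; head; tail; toList)
open import Function.Base using (id)
open import Function.Bundles using (Func; _⟨$⟩_)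
import Function.Relation.Binary.Setoid.Equality as FuncEquality
open import Level using (Level; _⊔_; 0ℓ)
open import Relation.Binary.Bundles using (Setoid)
open import Relation.Binary.PropositionalEquality.Core
  using (_≡_; refl; sym; trans; cong; subst)
open import Relation.Nullary.Decidable.Core using (Dec; yes; no)
open import Relation.Nullary.Negation.Core using (contradiction)

-- A^I for an index setoid I: all functions I → A, i.e. the maps of setoids,
-- with the pointwise A-module structure.

module _ {c ℓ : Level} (A : CommutativeRing c ℓ) (I : Setoid 0ℓ 0ℓ) where

  private
    module A = CommutativeRing A
    open FuncEquality I A.setoid using (_≈_; isEquivalence)

    V : Set (c ⊔ ℓ)
    V = Func I A.setoid

    _+ᵛ_ : V → V → V
    S +ᵛ T = record
      { to   = λ m → (S ⟨$⟩ m) A.+ (T ⟨$⟩ m)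
      ; cong = λ m≈n → A.+-cong (Func.cong S m≈n) (Func.cong T m≈n)
      }

    _*ᵛ_ : A.Carrier → V → V
    r *ᵛ T = record
      { to   = λ m → r A.* (T ⟨$⟩ m)
      ; cong = λ m≈n → A.*-congˡ (Func.cong T m≈n)
      }

    -ᵛ_ : V → V
    -ᵛ T = record
      { to   = λ m → A.- (T ⟨$⟩ m)
      ; cong = λ m≈n → A.-‿cong (Func.cong T m≈n)
      }

    0ᵛ : V
    0ᵛ = record { to = λ _ → A.0# ; cong = λ _ → A.refl }

    isModule : IsModule A _≈_ _+ᵛ_ 0ᵛ -ᵛ_ _*ᵛ_ (λ T r → r *ᵛ T)
    isModule = IsModuleFromLeft.isModule {commutativeRing = A} (record
      { isLeftModule = record
        { isLeftSemimodule = record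
          { +ᴹ-isCommutativeMonoid = record
            { isMonoid = record
              { isSemigroup = record
                { isMagma = record
                  { isEquivalence = isEquivalence
                  ; ∙-cong        = λ S≈S′ T≈T′ m → A.+-cong (S≈S′ m) (T≈T′ m)
                  }
                ; assoc = λ S T U m → A.+-assoc _ _ _
                }
              ; identity = (λ T m → A.+-identityˡ _) , (λ T m → A.+-identityʳ _)
              }
            ; comm = λ S T m → A.+-comm _ _
            }
          ; isPreleftSemimodule = record
            { *ₗ-cong      = λ r≈r′ T≈T′ m → A.*-cong r≈r′ (T≈T′ m)
            ; *ₗ-zeroˡ     = λ T m → A.zeroˡ _
            ; *ₗ-distribʳ  = λ T q r m → A.distribʳ _ _ _
            ; *ₗ-identityˡ = λ T m → A.*-identityˡ _
            ; *ₗ-assoc     = λ q r T m → A.*-assoc _ _ _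
            ; *ₗ-zeroʳ     = λ r m → A.zeroʳ _
            ; *ₗ-distribˡ  = λ r S T m → A.distribˡ _ _ _
            }
          }
        ; -ᴹ‿cong    = λ S≈T m → A.-‿cong (S≈T m)
        ; -ᴹ‿inverse = (λ T m → A.-‿inverseˡ _) , (λ T m → A.-‿inverseʳ _)
        }
      })

  powerModule : Module A (c ⊔ ℓ) ℓ
  powerModule = record { isModule = isModule }

-- A shape (n₁,…,n_k) with k ≥ 1 is a Vector ℕ (suc k′), where k = suc k′.

module _ {k : ℕ} (s : Vector ℕ (suc k)) where

  shapeDim : ℕ
  shapeDim = min (head s) (toList (tail s)) ∸ 1

  -- M_a(p) = n_a − 1 − n + p, summed in the order that makes M_a(p+1) reduce
  -- to suc (M_a(p)).  For positive shapes no subtraction is truncated.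
  M : ℕ → Fin (suc k) → ℕ
  M p a = p + (s a ∸ 1 ∸ shapeDim)

  Index : ℕ → Set
  Index p = (a : Fin (suc k)) → Fin (suc (M p a))

  indexSetoid : ℕ → Setoid 0ℓ 0ℓ
  indexSetoid p = record
    { Carrier       = Index p
    ; _≈_           = λ m n → ∀ a → m a ≡ n a
    ; isEquivalence = record
      { refl  = λ _ → refl
      ; sym   = λ m≈n a → sym (m≈n a)
      ; trans = λ m≈n n≈o a → trans (m≈n a) (n≈o a)
      }
    }

  record Stab : Set where
    field
      perm  : Permutation′ (suc k)
      fixes : ∀ a → s (perm ⟨$⟩ʳ a) ≡ s a

  private
    fixes⁻¹ : (σ : Stab) → ∀ a → s (Stab.perm σ ⟨$⟩ˡ a) ≡ s a
    fixes⁻¹ σ a = trans (sym (Stab.fixes σ (Stab.perm σ ⟨$⟩ˡ a)))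
                        (cong s (inverseʳ (Stab.perm σ)))

  _⁻¹ : Stab → Stab
  σ ⁻¹ = record { perm = flip (Stab.perm σ) ; fixes = fixes⁻¹ σ }

  -- The a-th coordinate of σ · m is m_{σ⁻¹(a)}; the cast only transports along
  -- M_{σ⁻¹(a)}(p) ≡ M_a(p) and leaves the underlying number unchanged.
  actIndex : Stab → (p : ℕ) → Index p → Index p
  actIndex σ p m a =
    cast (cong (λ x → suc (p + (x ∸ 1 ∸ shapeDim))) (fixes⁻¹ σ a))
         (m (Stab.perm σ ⟨$⟩ˡ a))

  Positive : {p : ℕ} → Index p → Set
  Positive m = ∀ a → 1 ≤ toℕ (m a)

  positive? : {p : ℕ} (m : Index p) → Dec (Positive m)
  positive? m = all? (λ a → 1 ≤? toℕ (m a))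

  -- m − (1,…,1)
  pred⃗ : {p : ℕ} (m : Index (suc p)) → Positive m → Index p
  pred⃗ m m>0 a = reduce≥ {1} (m a) (m>0 a)

  module _ {c ℓ : Level} (A : CommutativeRing c ℓ) where

    private
      module A = CommutativeRing A

    X : ℤ → Module A (c ⊔ ℓ) ℓ
    X (+ p)    = powerModule A (indexSetoid p)
    X -[1+ _ ] = Zero.⟨module⟩

    -- (σ · T)(m) = T(σ⁻¹ · m)
    act : Stab → (p : ℤ) → Func (Module.≈ᴹ-setoid (X p)) (Module.≈ᴹ-setoid (X p))
    act σ (+ p) = record
      { to = λ T → record
        { to   = λ m → T ⟨$⟩ actIndex (σ ⁻¹) p m
        ; cong = λ m≈n → Func.cong T (λ a → cong (cast _) (m≈n _))
        }
      ; cong = λ S≈T m → S≈T (actIndex (σ ⁻¹) p m)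
      }
    act σ -[1+ _ ] = record { to = id ; cong = id }

    -- The value of H_p(T) at m; not (all m_a > 0) is some m_a = 0.
    shift : {p : ℕ} → Func (indexSetoid p) A.setoid →
            (m : Index (suc p)) → Dec (Positive m) → A.Carrier
    shift T m (yes m>0) = T ⟨$⟩ pred⃗ m m>0
    shift T m (no  _)   = A.0#

    private
      reduce-cong : ∀ {n} {i j : Fin (suc n)} → i ≡ j →
                    .(i>0 : 1 ≤ toℕ i) .(j>0 : 1 ≤ toℕ j) →
                    reduce≥ {1} i i>0 ≡ reduce≥ {1} j j>0
      reduce-cong refl _ _ = refl

      shift-cong : {p : ℕ} (T : Func (indexSetoid p) A.setoid) {m n : Index (suc p)} →
                   (∀ a → m a ≡ n a) → (m? : Dec (Positive m)) (n? : Dec (Positive n)) →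
                   shift T m m? A.≈ shift T n n?
      shift-cong T m≈n (yes m>0) (yes n>0) =
        Func.cong T (λ a → reduce-cong (m≈n a) (m>0 a) (n>0 a))
      shift-cong T m≈n (yes m>0) (no n≯0) =
        contradiction (λ a → subst (λ i → 1 ≤ toℕ i) (m≈n a) (m>0 a)) n≯0
      shift-cong T m≈n (no m≯0) (yes n>0) =
        contradiction (λ a → subst (λ i → 1 ≤ toℕ i) (sym (m≈n a)) (n>0 a)) m≯0
      shift-cong T m≈n (no _) (no _) = A.refl

      shift-cong-fun : {p : ℕ} {S T : Func (indexSetoid p) A.setoid} →
                       (∀ m → (S ⟨$⟩ m) A.≈ (T ⟨$⟩ m)) →
                       (m : Index (suc p)) (m? : Dec (Positive m)) →
                       shift S m m? A.≈ shift T m m?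
      shift-cong-fun S≈T m (yes m>0) = S≈T (pred⃗ m m>0)
      shift-cong-fun S≈T m (no _)    = A.refl

    -- The clause for negative p gives H₋₁ = 0; for p < −1 it is the only map
    -- between zero modules.
    H : (p : ℤ) → Func (Module.≈ᴹ-setoid (X p)) (Module.≈ᴹ-setoid (X (ℤ.suc p)))
    H (+ p) = record
      { to = λ T → record
        { to   = λ m → shift T m (positive? m)
        ; cong = λ m≈n → shift-cong T m≈n (positive? _) (positive? _)
        }
      ; cong = λ S≈T m → shift-cong-fun S≈T m (positive? m)
      }
    H p@(-[1+ _ ]) = record
      { to   = λ _ → Module.0ᴹ (X (ℤ.suc p))
      ; cong = λ _ → Module.≈ᴹ-refl (X (ℤ.suc p))
      }

{-# OPTIONS --safe #-}
module Submission where

open import Defs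
open import Algebra.Bundles using (CommutativeRing)
open import Algebra.Module.Bundles using (Module)
open import Data.Fin.Base using (Fin; suc; toℕ; cast; reduce≥)
open import Data.Fin.Permutation using (_⟨$⟩ʳ_; inverseˡ)
open import Data.Fin.Properties using (toℕ-cast)
open import Data.Integer.Base as ℤ using (ℤ; -1ℤ; +_; -[1+_]; -≤-)
open import Data.Nat.Base using (ℕ; suc; _≤_)
open import Data.Vec.Functional using (Vector)
open import Function.Bundles using (Func; _⟨$⟩_)
open import Relation.Binary.PropositionalEquality.Core using (_≡_; refl; sym; subst)
open import Relation.Nullary.Decidable.Core using (Dec; yes; no)
open import Relation.Nullary.Negation.Core using (contradiction)

-- A permutation of coordinates fixes the vector (1,...,1) and preserves the property that every
-- coordinate is positive. So at an index m both sides vanish together, or both evaluate `T` at the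
-- same point, since σ⁻¹·(m - 1) = σ⁻¹·m - 1. `cast-reduce≥` gives this identity coordinatewise, and
-- the two `actIndex-positive` lemmas keep the vanishing conditions in step.

cast-reduce≥ : ∀ {m n} .(eq : m ≡ n) .(eq⁺ : suc m ≡ suc n) (i : Fin (suc m))
               .(i>0 : 1 ≤ toℕ i) .(j>0 : 1 ≤ toℕ (cast eq⁺ i)) →
               cast eq (reduce≥ {1} i i>0) ≡ reduce≥ {1} (cast eq⁺ i) j>0
cast-reduce≥ _ _ (suc i) _ _ = refl

module _ {k : ℕ} (s : Vector ℕ (suc k)) (σ : Stab s) {p : ℕ} (m : Index s p) where

  actIndex-positive⁺ : Positive s m → Positive s (actIndex s σ p m)
  actIndex-positive⁺ m>0 a = subst (1 ≤_) (sym (toℕ-cast _ _)) (m>0 _)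

  actIndex-positive⁻ : Positive s (actIndex s σ p m) → Positive s m
  actIndex-positive⁻ σm>0 a =
    -- Coordinate a of m reappears as coordinate σ(a) of σ·m.
    subst (λ b → 1 ≤ toℕ (m b)) (inverseˡ (Stab.perm σ))
      (subst (1 ≤_) (toℕ-cast _ _) (σm>0 (Stab.perm σ ⟨$⟩ʳ a)))

module _ {c ℓ} (A : CommutativeRing c ℓ) {k : ℕ} (s : Vector ℕ (suc k)) where

  private
    module A = CommutativeRing A

  -- Taking arbitrary decisions `m?` and `σ⁻¹m?` lets the two sides be split independently;
  -- invariance of positivity rules out the mixed cases.
  shift-act : (σ : Stab s) {p : ℕ} (T : Func (indexSetoid s p) A.setoid)
              (m : Index s (suc p)) (m? : Dec (Positive s m))
              (σ⁻¹m? : Dec (Positive s (actIndex s (_⁻¹ s σ) (suc p) m))) →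
              shift s A (act s A σ (+ p) ⟨$⟩ T) m m? A.≈
              shift s A T (actIndex s (_⁻¹ s σ) (suc p) m) σ⁻¹m?
  shift-act σ T m (yes m>0) (yes σ⁻¹m>0) =
    Func.cong T λ a → cast-reduce≥ _ _ (m _) (m>0 _) (σ⁻¹m>0 a)
  shift-act σ T m (yes m>0) (no σ⁻¹m≯0) =
    contradiction (actIndex-positive⁺ s (_⁻¹ s σ) m m>0) σ⁻¹m≯0
  shift-act σ T m (no m≯0) (yes σ⁻¹m>0) =
    contradiction (actIndex-positive⁻ s (_⁻¹ s σ) m σ⁻¹m>0) m≯0
  shift-act σ T m (no _) (no _) = A.refl

mainTheorem6 : ∀ {c ℓ} (A : CommutativeRing c ℓ) {k : ℕ} (s : Vector ℕ (suc k)) →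
    ((a : Fin (suc k)) → 1 ≤ s a) →
    (p : ℤ) → -1ℤ ℤ.≤ p → (σ : Stab s) (T : Module.Carrierᴹ (X s A p)) →
    Module._≈ᴹ_ (X s A (ℤ.suc p))
    (H s A p ⟨$⟩ (act s A σ p ⟨$⟩ T))
    (act s A σ (ℤ.suc p) ⟨$⟩ (H s A p ⟨$⟩ T))
mainTheorem6 A s _ (+ p) _ σ T m = shift-act A s σ T m (positive? s m) (positive? s _)
-- Here the target is X₀, not a zero module: both sides are the zero function, since permuting the
-- arguments of 0 gives 0.
mainTheorem6 A s _ -[1+ 0 ] _ σ T m = CommutativeRing.refl A
mainTheorem6 A s _ -[1+ suc _ ] (-≤- ()) σ T
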